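{- For all binary strings $x,y$, the minimal plain Kolmogorov complexity of a program that computes a prefix-stable function mapping $x$ to $y$ is equal to $\mathrm{C}(y\mid x*)+O(1)$, where the constant in $O(1)$ does not depend on $x$ and $y$.
   Context: A partial function $f$ from binary strings to binary strings is prefix-stable if for every $x$ such that $f(x)$ is defined, $f$ is defined and has the same value on all (finite) extensions of $x$. Programs (for computable partial functions) are binary strings in a fixed standard programming language, and plain Kolmogorov complexity of programs is taken with respect to a fixed optimal decompressor. A description mode is a set $D$ of triples $(p,x,y)$ of binary strings such that: (1) $D$ is computably enumerable; (2) for every $p$ and $x$ there is at most one $y$ such that $(p,x,y)\in D$; (3) if $(p,x,y)\in D$ and $x$ is a prefix of $x'$, then $(p,x',y)\in D$. For a description mode $D$ let $\mathrm{C}_D(y\mid x*)=\min\{|p| : (p,x,y)\in D\}$. There exists an optimal description mode, i.e., a $D$ such that $\mathrm{C}_D\le \mathrm{C}_{D'}+O(1)$ for every description mode $D'$; fix such a $D$ and write $\mathrm{C}(y\mid x*)$ for $\mathrm{C}_D(y\mid x*)$. -}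

module Defs where

open import Data.Bool.Base using (Bool; true)
open import Data.Fin.Base using (Fin)
open import Data.List.Base using (List; []; _∷_; length; replicate)
open import Data.List.Relation.Binary.Prefix.Heterogeneous using (Prefix)
open import Data.Nat.Base using (ℕ; suc; _+_; _≤_; _<_)
open import Data.Nat.Properties using (≤-refl; ≤-trans; +-monoˡ-≤)
open import Data.Product.Base using (∃; ∃₂; ∃-syntax; _×_; _,_)
open import Data.Vec.Base using (Vec; []; _∷_; lookup)
open import Data.Vec.Relation.Binary.Pointwise.Inductive using (Pointwise)
open import Function.Bundles using (_⇔_; mk⇔)
open import Relation.Binary.PropositionalEquality using (_≡_)

Str : Set
Str = List Bool

infix 4 _≼_

_≼_ : Str → Str → Set
_≼_ = Prefix _≡_

-- Partial recursive functions of n binary strings.  Recursion is on notation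
-- (over the bits of the first argument); minimization searches the strings 1ᵏ
-- for the first one mapped to [].

data Rec : ℕ → Set where
  nil  : ∀ {n} → Rec n
  cons : Bool → Rec 1
  proj : ∀ {n} → Fin n → Rec n
  comp : ∀ {m n} → Rec m → Vec (Rec n) m → Rec n
  rec  : ∀ {n} → Rec n → (Bool → Rec (suc (suc n))) → Rec (suc n)
  mu   : ∀ {n} → Rec (suc n) → Rec n

1^ : ℕ → Str
1^ k = replicate k true

infix 4 _[_]⇓_

-- f [ xs ]⇓ y : the value of f at xs is defined and equals y.

data _[_]⇓_ : ∀ {n} → Rec n → Vec Str n → Str → Set where
  ⇓nil  : ∀ {n} {xs : Vec Str n} → nil [ xs ]⇓ []
  ⇓cons : ∀ {b x} → cons b [ x ∷ [] ]⇓ (b ∷ x)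
  ⇓proj : ∀ {n} {i : Fin n} {xs} → proj i [ xs ]⇓ lookup xs i
  ⇓comp : ∀ {m n} {f : Rec m} {gs : Vec (Rec n) m} {xs ys z} →
          Pointwise (λ g y → g [ xs ]⇓ y) gs ys →
          f [ ys ]⇓ z →
          comp f gs [ xs ]⇓ z
  ⇓rec[] : ∀ {n} {f : Rec n} {h : Bool → Rec (suc (suc n))} {xs y} →
           f [ xs ]⇓ y →
           rec f h [ [] ∷ xs ]⇓ y
  ⇓rec∷  : ∀ {n} {f : Rec n} {h : Bool → Rec (suc (suc n))} {b x xs r y} →
           rec f h [ x ∷ xs ]⇓ r →
           h b [ x ∷ r ∷ xs ]⇓ y →
           rec f h [ (b ∷ x) ∷ xs ]⇓ y
  ⇓mu   : ∀ {n} {f : Rec (suc n)} {xs k} →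
          f [ 1^ k ∷ xs ]⇓ [] →
          (∀ {j} → j < k → ∃₂ λ b z → f [ 1^ j ∷ xs ]⇓ (b ∷ z)) →
          mu f [ xs ]⇓ 1^ k

-- A programming language: φ (p , x) is the output of program p on input x.
-- It is standard when every two-argument partial recursive function is
-- simulated through a total computable translation of programs s, i.e. when
-- φ is a Gödel (acceptable) numbering.

IsGödelNumbering : Rec 2 → Set
IsGödelNumbering φ =
  ∀ (v : Rec 2) → ∃[ s ] ∀ p → ∃[ p′ ]
    s [ p ∷ [] ]⇓ p′ ×
    (∀ x y → φ [ p′ ∷ x ∷ [] ]⇓ y ⇔ v [ p ∷ x ∷ [] ]⇓ y)

-- The partial function with graph f.

PrefixStable : (Str → Str → Set) → Set
PrefixStable f = ∀ {x y x′} → f x y → x ≼ x′ → f x′ y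

-- Elements of ℕ ∪ {∞}, given by their natural upper bounds: a k means a ≤ k.
-- Kolmogorov complexities are minima that exist only classically, so they
-- are not available as elements of ℕ.

ℕ∞ : Set₁
ℕ∞ = ℕ → Set

fin : ℕ → ℕ∞
fin n k = n ≤ k

-- min { f a : a satisfies P }, equal to ∞ when no a satisfies P.

Min : {A : Set} → (A → Set) → (A → ℕ∞) → ℕ∞
Min P f k = ∃[ a ] P a × f a k

infix 4 _≤∞[_]_ _≤⁺_ _=⁺_

-- a ≤ b + c.

_≤∞[_]_ : ℕ∞ → ℕ → ℕ∞ → Set
a ≤∞[ c ] b = ∀ k → b k → a (k + c)

fin-≤∞ : ∀ {m n c} → fin m ≤∞[ c ] fin n ⇔ m ≤ n + c
fin-≤∞ {c = c} = mk⇔ (λ h → h _ ≤-refl) (λ p _ q → ≤-trans p (+-monoˡ-≤ c q))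

Min-fin : ∀ {A : Set} {P : A → Set} {f : A → ℕ} {a} →
          P a → (∀ {b} → P b → f a ≤ f b) →
          ∀ k → Min P (λ b → fin (f b)) k ⇔ fin (f a) k
Min-fin Pa least k =
  mk⇔ (λ (_ , Pb , fb≤k) → ≤-trans (least Pb) fb≤k) (λ fa≤k → _ , Pa , fa≤k)

-- F ≤ G + O(1) and F = G + O(1), the constant being uniform in the index.

_≤⁺_ : {I : Set} → (I → ℕ∞) → (I → ℕ∞) → Set
F ≤⁺ G = ∃[ c ] ∀ i → F i ≤∞[ c ] G i

_=⁺_ : {I : Set} → (I → ℕ∞) → (I → ℕ∞) → Set
F =⁺ G = ∃[ c ] ∀ i → (F i ≤∞[ c ] G i) × (G i ≤∞[ c ] F i)

PlainC : Rec 1 → Str → ℕ∞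
PlainC U z = Min (λ q → U [ q ∷ [] ]⇓ z) (λ q → fin (length q))

IsOptimalDecompressor : Rec 1 → Set
IsOptimalDecompressor U = ∀ V → PlainC U ≤⁺ PlainC V

Triples : Set₁
Triples = Str → Str → Str → Set

-- Computably enumerable sets are the domains of partial recursive functions.

CE : Triples → Set
CE D = ∃[ e ] ∀ p x y → D p x y ⇔ (∃[ z ] e [ p ∷ x ∷ y ∷ [] ]⇓ z)

record IsDescriptionMode (D : Triples) : Set where
  field
    enumerable : CE D
    functional : ∀ {p x y y′} → D p x y → D p x y′ → y ≡ y′
    stable     : ∀ {p x x′ y} → D p x y → x ≼ x′ → D p x′ y

-- C_D(y | x*) at the index (x , y).

PrefixC : Triples → Str × Str → ℕ∞
PrefixC D (x , y) = Min (λ p → D p x y) (λ p → fin (length p))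

record IsOptimalDescriptionMode (D : Triples) : Set₁ where
  field
    isDescriptionMode : IsDescriptionMode D
    optimal : ∀ D′ → IsDescriptionMode D′ → PrefixC D ≤⁺ PrefixC D′

-- The least plain complexity of a program computing a prefix-stable function
-- that maps x to y, at the index (x , y).

ProgramC : (φ : Rec 2) (U : Rec 1) → Str × Str → ℕ∞
ProgramC φ U (x , y) = Min (λ p → PrefixStable (computes p) × computes p x y) (PlainC U)
  where
  computes : Str → Str → Str → Set
  computes p x y = φ [ p ∷ x ∷ [] ]⇓ y

{-# OPTIONS --safe #-}
module Submission where

-- A description mode D becomes a single program with two arguments by searching
-- for a y such that D (p , x , y) is enumerated; translating it into φ gives for
-- each p a prefix-stable program of complexity at most |p| + O(1).  Conversely,
-- let q describe a program p.  Enumerate the halting computations of p and keep a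
-- pair (x , y) when no earlier one gives another value at a string comparable with
-- x.  The kept pairs, extended to all x′ ≽ x, form a description mode whatever
-- p is, and nothing is dropped when p computes a prefix-stable function.
-- Both searches rest on a computable evaluator with bounded minimization.

open import Defs
open import Data.Bool.Base using (Bool; true; false; if_then_else_; _xor_)
open import Data.Empty using (⊥-elim)
open import Data.Fin.Base using (Fin; suc)
open import Data.Fin.Patterns using (0F; 1F; 2F; 3F; 4F)
open import Data.List.Base using ([]; _∷_; _++_; length; drop; reverse; foldl; foldr)
open import Data.List.Properties
  using (unfold-reverse; reverse-foldr; ++-conicalˡ; ++-conicalʳ; length-replicate)
import Data.List.Relation.Binary.Pointwise as Listwise
open import Data.List.Relation.Binary.Prefix.Heterogeneous using ([]; _∷_)
import Data.List.Relation.Binary.Prefix.Heterogeneous.Properties as Prefix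
open import Data.Nat.Base using (ℕ; zero; suc; _≤_; _<_; _⊔_; s≤s)
open import Data.Nat.Properties
  using (≤-trans; ≤-refl; ≤-reflexive; m≤m⊔n; m≤n⊔m; m⊔n≤o⇒m≤o; m⊔n≤o⇒n≤o;
         m≤n⇒m<n∨m≡n; <-cmp; <⇒≤; n<1+n; +-monoʳ-≤)
open import Data.Product.Base using (∃; ∃₂; ∃-syntax; _×_; _,_; proj₁; proj₂)
open import Data.Sum.Base using (_⊎_; inj₁; inj₂)
open import Data.Vec.Base using (Vec; []; _∷_; lookup; head; tail; tabulate; map)
open import Data.Vec.Properties using (tabulate∘lookup)
open import Data.Vec.Relation.Binary.Pointwise.Inductive as Pointwise using (Pointwise; []; _∷_)
open import Function.Base using (id; _∘_; flip)
open import Function.Bundles using (_⇔_; mk⇔; Equivalence)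
open import Relation.Binary.Definitions using (tri<; tri≈; tri>)
open import Relation.Binary.PropositionalEquality
  using (_≡_; _≢_; refl; sym; trans; cong; subst)

-- Computable total functions and their closure properties.

record Computable {n} (F : Vec Str n → Str) : Set where
  constructor _,_
  field
    code     : Rec n
    computes : ∀ xs → code [ xs ]⇓ F xs

open Computable

record Computableⱽ {m n} (F : Vec Str n → Vec Str m) : Set where
  constructor _,_
  field
    codes    : Vec (Rec n) m
    computes : ∀ xs → Pointwise (λ g y → g [ xs ]⇓ y) codes (F xs)

[]ⱽ : ∀ {n} → Computableⱽ {0} {n} (λ _ → [])
[]ⱽ = [] , λ _ → []

infixr 5 _∷ⱽ_

_∷ⱽ_ : ∀ {m n} {F : Vec Str n → Str} {G : Vec Str n → Vec Str m} →
       Computable F → Computableⱽ G → Computableⱽ (λ xs → F xs ∷ G xs)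
(f , F-ok) ∷ⱽ (gs , G-ok) = (f ∷ gs) , λ xs → F-ok xs ∷ G-ok xs

idⱽ : ∀ {n} → Computableⱽ {n} id
idⱽ = tabulate proj ,
  λ xs → subst (Pointwise _ _) (tabulate∘lookup xs) (Pointwise.tabulate⁺ λ _ → ⇓proj)

tailⱽ : ∀ {m n} {F : Vec Str n → Vec Str (suc m)} → Computableⱽ F → Computableⱽ (tail ∘ F)
tailⱽ {F = F} (f ∷ fs , F-ok) = fs , λ xs → tail-ok (F xs) (F-ok xs)
  where
  tail-ok : ∀ {xs} ys → Pointwise (λ g y → g [ xs ]⇓ y) (f ∷ fs) ys →
            Pointwise (λ g y → g [ xs ]⇓ y) fs (tail ys)
  tail-ok _ (_ ∷ ps) = ps

ext : ∀ {n} {F G : Vec Str n → Str} → Computable F → (∀ xs → F xs ≡ G xs) → Computable G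
ext (f , F-ok) F≗G = f , λ xs → subst (f [ xs ]⇓_) (F≗G xs) (F-ok xs)

var : ∀ {n} (i : Fin n) → Computable (λ xs → lookup xs i)
var i = proj i , λ _ → ⇓proj

headᶜ : ∀ {n} → Computable {suc n} head
headᶜ = ext (var 0F) λ { (_ ∷ _) → refl }

[]ᶜ : ∀ {n} → Computable {n} (λ _ → [])
[]ᶜ = nil , λ _ → ⇓nil

infixr 4 _∘ᶜ_

_∘ᶜ_ : ∀ {m n} {F : Vec Str m → Str} {G : Vec Str n → Vec Str m} →
       Computable F → Computableⱽ G → Computable (F ∘ G)
_∘ᶜ_ {G = G} (f , F-ok) (gs , G-ok) = comp f gs , λ xs → ⇓comp (G-ok xs) (F-ok (G xs))

infixr 5 _∷ᶜ_

_∷ᶜ_ : ∀ {n} {F : Vec Str n → Str} (b : Bool) → Computable F → Computable (λ xs → b ∷ F xs)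
b ∷ᶜ (f , F-ok) = comp (cons b) (f ∷ []) , λ xs → ⇓comp (F-ok xs ∷ []) ⇓cons

-- The recursion equations are hypotheses because some functions, `reverse` among them, satisfy them
-- only propositionally.
recᶜ : ∀ {n} (R : Str → Vec Str n → Str) {S₀ S₁ : Vec Str (suc (suc n)) → Str} →
       Computable (R []) → Computable S₀ → Computable S₁ →
       (∀ x xs → R (false ∷ x) xs ≡ S₀ (x ∷ R x xs ∷ xs)) →
       (∀ x xs → R (true ∷ x) xs ≡ S₁ (x ∷ R x xs ∷ xs)) →
       Computable (λ xs → R (head xs) (tail xs))
recᶜ R (r , R-ok) (s₀ , S₀-ok) (s₁ , S₁-ok) eq₀ eq₁ = code′ , λ { (x ∷ xs) → ok x xs }
  where
  code′ = rec r λ b → if b then s₁ else s₀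

  ok : ∀ x xs → code′ [ x ∷ xs ]⇓ R x xs
  ok []          xs = ⇓rec[] (R-ok xs)
  ok (false ∷ x) xs rewrite eq₀ x xs = ⇓rec∷ (ok x xs) (S₀-ok _)
  ok (true ∷ x)  xs rewrite eq₁ x xs = ⇓rec∷ (ok x xs) (S₁-ok _)

ifᶜ : ∀ {n} {F G : Vec Str n → Str} b → Computable F → Computable G →
      Computable (λ xs → if b then F xs else G xs)
ifᶜ false F G = G
ifᶜ true  F G = F

module _ {n} {F : Vec Str n → Str} (Fᶜ : Computable F) where

  drop₁ᶜ : Computable (λ xs → drop 1 (F xs))
  drop₁ᶜ = recᶜ (λ x _ → drop 1 x) []ᶜ (var 0F) (var 0F) (λ _ _ → refl) (λ _ _ → refl) ∘ᶜ Fᶜ ∷ⱽ []ⱽ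

  unaryᶜ : Computable (λ xs → 1^ (length (F xs)))
  unaryᶜ = recᶜ (λ x _ → 1^ (length x)) []ᶜ (true ∷ᶜ var 1F) (true ∷ᶜ var 1F)
             (λ _ _ → refl) (λ _ _ → refl) ∘ᶜ Fᶜ ∷ⱽ []ⱽ

infixr 5 _++ᶜ_

_++ᶜ_ : ∀ {n} {F G : Vec Str n → Str} →
        Computable F → Computable G → Computable (λ xs → F xs ++ G xs)
F ++ᶜ G = recᶜ (λ x ys → x ++ lookup ys 0F) (var 0F) (false ∷ᶜ var 1F) (true ∷ᶜ var 1F)
            (λ _ _ → refl) (λ _ _ → refl) ∘ᶜ F ∷ⱽ G ∷ⱽ []ⱽ

reverseᶜ : ∀ {n} {F : Vec Str n → Str} → Computable F → Computable (λ xs → reverse (F xs))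
reverseᶜ F = recᶜ (λ x _ → reverse x) []ᶜ
               (var 1F ++ᶜ false ∷ᶜ []ᶜ) (var 1F ++ᶜ true ∷ᶜ []ᶜ)
               (λ x _ → unfold-reverse false x) (λ x _ → unfold-reverse true x) ∘ᶜ F ∷ⱽ []ⱽ

-- Logical connectives on strings.

-- Strings are used as truth values with [] for truth, the value sought by mu,
-- so that _++_ is conjunction.

not : Str → Str
not []      = true ∷ []
not (_ ∷ _) = []

infixr 6 _∨_

_∨_ : Str → Str → Str
[]      ∨ y = []
(_ ∷ _) ∨ y = y

notᶜ : ∀ {n} {F : Vec Str n → Str} → Computable F → Computable (λ xs → not (F xs))
notᶜ F = recᶜ (λ x _ → not x) (true ∷ᶜ []ᶜ) []ᶜ []ᶜ (λ _ _ → refl) (λ _ _ → refl) ∘ᶜ F ∷ⱽ []ⱽ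

infixr 6 _∨ᶜ_

_∨ᶜ_ : ∀ {n} {F G : Vec Str n → Str} →
       Computable F → Computable G → Computable (λ xs → F xs ∨ G xs)
F ∨ᶜ G = recᶜ (λ x ys → x ∨ lookup ys 0F) []ᶜ (var 2F) (var 2F)
           (λ _ _ → refl) (λ _ _ → refl) ∘ᶜ F ∷ⱽ G ∷ⱽ []ⱽ

∨-elim : ∀ x {y} → x ∨ y ≡ [] → x ≡ [] ⊎ y ≡ []
∨-elim []      _ = inj₁ refl
∨-elim (_ ∷ _) p = inj₂ p

∨-introˡ : ∀ {x y} → x ≡ [] → x ∨ y ≡ []
∨-introˡ refl = refl

∨-introʳ : ∀ x {y} → y ≡ [] → x ∨ y ≡ []
∨-introʳ []      _ = refl
∨-introʳ (_ ∷ _) p = p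

++-intro : {x y : Str} → x ≡ [] → y ≡ [] → x ++ y ≡ []
++-intro refl refl = refl

-- Deciding prefixes, equality and comparability.

-- The state [] records a mismatch, true ∷ y that y remains to be read.

match₁ : Bool → Str → Str
match₁ b []      = []
match₁ b (c ∷ y) = if b xor c then [] else true ∷ y

match : Bool → Str → Str
match b []      = []
match b (_ ∷ y) = match₁ b y

prefix : Str → Str → Str
prefix x y = not (foldl (flip match) (true ∷ y) x)

matchᶜ : ∀ {n} {F : Vec Str n → Str} b → Computable F → Computable (λ xs → match b (F xs))
matchᶜ b F =
  recᶜ (λ x _ → match b x) []ᶜ match₁-var match₁-var (λ _ _ → refl) (λ _ _ → refl) ∘ᶜ F ∷ⱽ []ⱽ
  where
  match₁-var : Computable (λ (xs : Vec Str 2) → match₁ b (lookup xs 0F))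
  match₁-var =
    recᶜ (λ x _ → match₁ b x) []ᶜ
      (ifᶜ (b xor false) []ᶜ (true ∷ᶜ var 0F)) (ifᶜ (b xor true) []ᶜ (true ∷ᶜ var 0F))
      (λ _ _ → refl) (λ _ _ → refl) ∘ᶜ var 0F ∷ⱽ []ⱽ

-- Recursion on notation processes the last bit first, while matching starts at the front; the left
-- fold is therefore computed as a right fold over the reversed string.
prefixᶜ : ∀ {n} {F G : Vec Str n → Str} → Computable F → Computable G →
          Computable (λ xs → prefix (F xs) (G xs))
prefixᶜ {F = F} Fᶜ Gᶜ =
  ext (notᶜ (recᶜ (λ x ys → foldr match (true ∷ lookup ys 0F) x)
               (true ∷ᶜ var 0F) (matchᶜ false (var 1F)) (matchᶜ true (var 1F))
               (λ _ _ → refl) (λ _ _ → refl) ∘ᶜ reverseᶜ Fᶜ ∷ⱽ Gᶜ ∷ⱽ []ⱽ))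
      (λ xs → cong not (reverse-foldr match _ (F xs)))

-- A mismatch is final. In `prefix-sound` this refutes the hypothesis when two bits differ or `y` is
-- too short.
foldl-match-[] : ∀ x → foldl (flip match) [] x ≡ []
foldl-match-[] []      = refl
foldl-match-[] (_ ∷ x) = foldl-match-[] x

prefix-complete : ∀ {x y} → x ≼ y → prefix x y ≡ []
prefix-complete []                     = refl
prefix-complete {false ∷ _} (refl ∷ p) = prefix-complete p
prefix-complete {true ∷ _}  (refl ∷ p) = prefix-complete p

prefix-sound : ∀ x y → prefix x y ≡ [] → x ≼ y
prefix-sound []          y           _ = []
prefix-sound (_ ∷ x)     []          p rewrite foldl-match-[] x with () ← p
prefix-sound (false ∷ x) (false ∷ y) p = refl ∷ prefix-sound x y p
prefix-sound (false ∷ x) (true ∷ y)  p rewrite foldl-match-[] x with () ← p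
prefix-sound (true ∷ x)  (false ∷ y) p rewrite foldl-match-[] x with () ← p
prefix-sound (true ∷ x)  (true ∷ y)  p = refl ∷ prefix-sound x y p

≼-refl : ∀ {x} → x ≼ x
≼-refl = Prefix.fromPointwise (Listwise.refl refl)

≼-trans : ∀ {x y z} → x ≼ y → y ≼ z → x ≼ z
≼-trans = Prefix.trans trans

≼-antisym : ∀ {x y} → x ≼ y → y ≼ x → x ≡ y
≼-antisym p q = Listwise.Pointwise-≡⇒≡ (Prefix.antisym (λ x≡y _ → x≡y) p q)

≼-comparable : ∀ {x y z} → x ≼ z → y ≼ z → x ≼ y ⊎ y ≼ x
≼-comparable []         _          = inj₁ []
≼-comparable (refl ∷ _) []         = inj₂ []
≼-comparable (refl ∷ p) (refl ∷ q) with ≼-comparable p q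
... | inj₁ r = inj₁ (refl ∷ r)
... | inj₂ r = inj₂ (refl ∷ r)

equal : Str → Str → Str
equal x y = prefix x y ++ prefix y x

equal-refl : ∀ x → equal x x ≡ []
equal-refl x = ++-intro (prefix-complete (≼-refl {x})) (prefix-complete (≼-refl {x}))

equal-sound : ∀ x y → equal x y ≡ [] → x ≡ y
equal-sound x y p =
  ≼-antisym (prefix-sound x y (++-conicalˡ _ _ p)) (prefix-sound y x (++-conicalʳ (prefix x y) _ p))

comparable : Str → Str → Str
comparable x y = prefix x y ∨ prefix y x

comparable-complete : ∀ {x y} → x ≼ y ⊎ y ≼ x → comparable x y ≡ []
comparable-complete         (inj₁ p) = ∨-introˡ (prefix-complete p)
comparable-complete {x} {y} (inj₂ p) = ∨-introʳ (prefix x y) (prefix-complete p)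

comparable-sound : ∀ x y → comparable x y ≡ [] → x ≼ y ⊎ y ≼ x
comparable-sound x y p with ∨-elim (prefix x y) p
... | inj₁ q = inj₁ (prefix-sound x y q)
... | inj₂ q = inj₂ (prefix-sound y x q)

-- Evaluation with a clock.

guards : ∀ {m} → Vec Str m → Str → Str
guards []       y = y
guards (x ∷ xs) y = x ∨ guards xs y

-- The state of a search is [] while it goes on, false ∷ [] when an undefined
-- value has been met, and true ∷ y when the result y has been found.

seek : Str → Str → Str → Str
seek (b ∷ s) _           _ = b ∷ s
seek []      []          _ = false ∷ []
seek []      (_ ∷ [])    y = true ∷ y
seek []      (_ ∷ _ ∷ _) _ = []

found : Str → Str
found []          = []
found (false ∷ _) = []
found (true ∷ y)  = true ∷ y

-- The result of evaluating f with the length of t bounding every search: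
-- true ∷ y for the value y, and [] when the bound is exceeded.  In this encoding
-- x ∨ z is z if x is a value and undefined otherwise.

clock : ∀ {n} → Rec n → Str → Vec Str n → Str
clocks : ∀ {m n} → Vec (Rec n) m → Str → Vec Str n → Vec Str m
-- The candidates `1^ j` with `j` below the length of the last argument are tested in increasing
-- order. An undefined value ends the search, since `mu` has a value only if all earlier values are
-- defined.
trial : ∀ {n} → Rec (suc n) → Str → Vec Str n → Str → Str

clock nil         t xs             = true ∷ []
clock (cons b)    t (x ∷ [])       = true ∷ b ∷ x
clock (proj i)    t xs             = true ∷ lookup xs i
clock (comp f gs) t xs             =
  guards (clocks gs t xs) (clock f t (map (drop 1) (clocks gs t xs)))
clock (rec f h)   t ([] ∷ xs)      = clock f t xs
clock (rec f h)   t ((b ∷ x) ∷ xs) =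
  clock (rec f h) t (x ∷ xs) ∨ clock (h b) t (x ∷ drop 1 (clock (rec f h) t (x ∷ xs)) ∷ xs)
clock (mu f)      t xs             = found (trial f t xs t)

clocks []       t xs = []
clocks (g ∷ gs) t xs = clock g t xs ∷ clocks gs t xs

trial f t xs []      = []
trial f t xs (_ ∷ z) =
  seek (trial f t xs z) (clock f t (1^ (length z) ∷ xs)) (1^ (length z))

seekᶜ : ∀ {n} {F G H : Vec Str n → Str} → Computable F → Computable G → Computable H →
        Computable (λ xs → seek (F xs) (G xs) (H xs))
seekᶜ F G H =
  recᶜ (λ s ys → seek s (lookup ys 0F) (lookup ys 1F))
    (recᶜ (λ c ys → seek [] c (lookup ys 0F)) (false ∷ᶜ []ᶜ) (more false) (more true)
       (λ _ _ → refl) (λ _ _ → refl)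
       ∘ᶜ var 0F ∷ⱽ var 1F ∷ⱽ []ⱽ)
    (false ∷ᶜ var 0F) (true ∷ᶜ var 0F) (λ _ _ → refl) (λ _ _ → refl) ∘ᶜ F ∷ⱽ G ∷ⱽ H ∷ⱽ []ⱽ
  where
  more : ∀ b → Computable (λ (ys : Vec Str 3) → seek [] (b ∷ lookup ys 0F) (lookup ys 2F))
  more b = recᶜ (λ c ys → seek [] (b ∷ c) (lookup ys 0F)) (true ∷ᶜ var 0F) []ᶜ []ᶜ
           (λ _ _ → refl) (λ _ _ → refl) ∘ᶜ var 0F ∷ⱽ var 2F ∷ⱽ []ⱽ

foundᶜ : ∀ {n} {F : Vec Str n → Str} → Computable F → Computable (λ xs → found (F xs))
foundᶜ F = recᶜ (λ x _ → found x) []ᶜ []ᶜ (true ∷ᶜ var 0F) (λ _ _ → refl) (λ _ _ → refl) ∘ᶜ F ∷ⱽ []ⱽ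

-- By induction on `f`: each `f` has its own clocked program, built from those of its parts, and `f`
-- itself is never an input.
clockᶜ : ∀ {n} (f : Rec n) → Computable (λ ts → clock f (head ts) (tail ts))
guardsᶜ : ∀ {m n} (gs : Vec (Rec n) m) {F : Vec Str (suc n) → Str} → Computable F →
          Computable (λ ts → guards (clocks gs (head ts) (tail ts)) (F ts))
outputsᶜ : ∀ {m n} (gs : Vec (Rec n) m) →
           Computableⱽ (λ ts → map (drop 1) (clocks gs (head ts) (tail ts)))
trialᶜ : ∀ {n} (f : Rec (suc n)) →
         Computable (λ zs → trial f (head (tail zs)) (tail (tail zs)) (head zs))

clockᶜ nil         = true ∷ᶜ []ᶜ
clockᶜ (cons b)    = ext (true ∷ᶜ b ∷ᶜ var 1F) λ { (_ ∷ _ ∷ []) → refl }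
clockᶜ (proj i)    = ext (true ∷ᶜ var (suc i)) λ { (_ ∷ _) → refl }
clockᶜ (comp f gs) = guardsᶜ gs (clockᶜ f ∘ᶜ headᶜ ∷ⱽ outputsᶜ gs)
clockᶜ (rec f h)   =
  -- `recᶜ` wants the recursion argument first, so it changes places with the time bound.
  ext (recᶜ (λ x ts → clock (rec f h) (head ts) (x ∷ tail ts))
         (clockᶜ f) (step false) (step true) (λ _ _ → refl) (λ _ _ → refl)
         ∘ᶜ var 1F ∷ⱽ headᶜ ∷ⱽ tailⱽ (tailⱽ idⱽ))
      λ { (_ ∷ _ ∷ _) → refl }
  where
  step : ∀ b → Computable _
  step b =
    var 1F ∨ᶜ
    (clockᶜ (h b) ∘ᶜ (headᶜ ∘ᶜ tailⱽ (tailⱽ idⱽ)) ∷ⱽ var 0F ∷ⱽ drop₁ᶜ (var 1F) ∷ⱽ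
       tailⱽ (tailⱽ (tailⱽ idⱽ)))
clockᶜ (mu f)      = foundᶜ (trialᶜ f ∘ᶜ headᶜ ∷ⱽ headᶜ ∷ⱽ tailⱽ idⱽ)

guardsᶜ []       F = F
guardsᶜ (g ∷ gs) F = clockᶜ g ∨ᶜ guardsᶜ gs F

outputsᶜ []       = []ⱽ
outputsᶜ (g ∷ gs) = drop₁ᶜ (clockᶜ g) ∷ⱽ outputsᶜ gs

trialᶜ f = recᶜ (λ z ts → trial f (head ts) (tail ts) z) []ᶜ step step (λ _ _ → refl) (λ _ _ → refl)
  where
  step : Computable _
  step =
    seekᶜ (var 1F)
      (clockᶜ f ∘ᶜ (headᶜ ∘ᶜ tailⱽ (tailⱽ idⱽ)) ∷ⱽ unaryᶜ (var 0F) ∷ⱽ tailⱽ (tailⱽ (tailⱽ idⱽ)))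
      (unaryᶜ (var 0F))

-- Soundness and completeness of the clocked evaluator.

≡∷⇒≢[] : ∀ {x y : Str} {b} → x ≡ b ∷ y → x ≢ []
≡∷⇒≢[] refl ()

∨-defined : ∀ x {y b z} → x ∨ y ≡ b ∷ z → ∃[ c ] x ≡ c ∷ drop 1 x × y ≡ b ∷ z
∨-defined (c ∷ _) p = c , refl , p

-- The leading bit is arbitrary because `∨-defined` tells only that a guard is non-empty.
clock-sound : ∀ {n} (f : Rec n) t xs {b y} → clock f t xs ≡ b ∷ y → f [ xs ]⇓ y
clocks-sound : ∀ {m n} (gs : Vec (Rec n) m) t xs {z b y} →
               guards (clocks gs t xs) z ≡ b ∷ y →
               Pointwise (λ g y → g [ xs ]⇓ y) gs (map (drop 1) (clocks gs t xs)) × z ≡ b ∷ y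
-- Only a defined non-empty value leaves the state at `[]`, so a running search supplies the second
-- premise of `⇓mu`.
trial-running : ∀ {n} (f : Rec (suc n)) t xs z → trial f t xs z ≡ [] →
                ∀ {j} → j < length z → ∃₂ λ b w → f [ 1^ j ∷ xs ]⇓ (b ∷ w)
trial-found : ∀ {n} (f : Rec (suc n)) t xs z {y} → trial f t xs z ≡ true ∷ y → mu f [ xs ]⇓ y

clock-sound nil         t xs             refl = ⇓nil
clock-sound (cons b)    t (x ∷ [])       refl = ⇓cons
clock-sound (proj i)    t xs             refl = ⇓proj
clock-sound (comp f gs) t xs             p    =
  let gs⇓ , q = clocks-sound gs t xs p in ⇓comp gs⇓ (clock-sound f t _ q)
clock-sound (rec f h)   t ([] ∷ xs)      p    = ⇓rec[] (clock-sound f t xs p)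
clock-sound (rec f h)   t ((b ∷ x) ∷ xs) p   =
  let _ , q , r = ∨-defined _ p
  in ⇓rec∷ (clock-sound (rec f h) t (x ∷ xs) q) (clock-sound (h b) t _ r)
clock-sound (mu f)      t xs             p with trial f t xs t in q | p
... | true ∷ _ | refl = trial-found f t xs t q

clocks-sound []       t xs p = [] , p
clocks-sound (g ∷ gs) t xs p =
  let _ , q , r = ∨-defined _ p
      gs⇓ , s   = clocks-sound gs t xs r
  in clock-sound g t xs q ∷ gs⇓ , s

trial-running f t xs (_ ∷ z) p j<
  with trial f t xs z in q | clock f t (1^ (length z) ∷ xs) in r | p
... | [] | b ∷ c ∷ w | _ with m≤n⇒m<n∨m≡n j<
...   | inj₁ (s≤s j<z) = trial-running f t xs z q j<z
...   | inj₂ refl      = c , w , clock-sound f t _ r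

trial-found f t xs (_ ∷ z) p
  with trial f t xs z in q | clock f t (1^ (length z) ∷ xs) in r | p
... | true ∷ _ | _      | refl = trial-found f t xs z q
... | []       | _ ∷ [] | refl = ⇓mu (clock-sound f t _ r) (trial-running f t xs z q)

-- Each bound covers all longer `t`, so the maximum serves for every `j`. This handles the
-- evaluations that precede the zero found by `mu`.
uniform-bound : ∀ {P : ℕ → Str → Set} k →
                (∀ {j} → j < k → ∃[ m ] ∀ t → m ≤ length t → P j t) →
                ∃[ m ] ∀ t → m ≤ length t → ∀ {j} → j < k → P j t
uniform-bound zero    _ = 0 , λ _ _ ()
uniform-bound {P} (suc k) h =
  let m , p = h (n<1+n k)
      n , q = uniform-bound k λ j<k → h (≤-trans j<k (<⇒≤ (n<1+n k)))
  in m ⊔ n , λ t m⊔n≤t {j} j<1+k →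
    case-≤ t (p t (m⊔n≤o⇒m≤o m n m⊔n≤t)) (q t (m⊔n≤o⇒n≤o m n m⊔n≤t)) j<1+k
  where
  case-≤ : ∀ t → P k t → (∀ {j} → j < k → P j t) → ∀ {j} → j < suc k → P j t
  case-≤ t p q j<1+k with m≤n⇒m<n∨m≡n j<1+k
  ... | inj₁ (s≤s j<k) = q j<k
  ... | inj₂ refl      = p

-- By induction on the derivation, with the maximum of the bounds of its premises. Quantifying over
-- all long enough `t` lets these bounds be combined directly.
clock-complete : ∀ {n} (f : Rec n) xs {y} → f [ xs ]⇓ y →
                 ∃[ m ] ∀ t → m ≤ length t → clock f t xs ≡ true ∷ y
clocks-complete : ∀ {m n} (gs : Vec (Rec n) m) xs {ys} → Pointwise (λ g y → g [ xs ]⇓ y) gs ys →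
                  ∃[ k ] ∀ t → k ≤ length t →
                  map (drop 1) (clocks gs t xs) ≡ ys × (∀ z → guards (clocks gs t xs) z ≡ z)

clock-complete nil         xs       ⇓nil  = 0 , λ _ _ → refl
clock-complete (cons b)    (_ ∷ []) ⇓cons = 0 , λ _ _ → refl
clock-complete (proj i)    xs       ⇓proj = 0 , λ _ _ → refl
clock-complete (comp f gs) xs (⇓comp gs⇓ f⇓) =
  let m , p = clocks-complete gs xs gs⇓
      n , q = clock-complete f _ f⇓
  in m ⊔ n , λ t m⊔n≤t →
    let outputs≡ , guards≡ = p t (m⊔n≤o⇒m≤o m n m⊔n≤t)
    in trans (guards≡ _) (trans (cong (clock f t) outputs≡) (q t (m⊔n≤o⇒n≤o m n m⊔n≤t)))
clock-complete (rec f h) ([] ∷ xs) (⇓rec[] f⇓) = clock-complete f xs f⇓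
clock-complete (rec f h) ((b ∷ x) ∷ xs) {y} (⇓rec∷ {r = r} r⇓ h⇓) =
  let m , p = clock-complete (rec f h) (x ∷ xs) r⇓
      n , q = clock-complete (h b) _ h⇓
  in m ⊔ n , λ t m⊔n≤t →
    trans (cong (λ s → s ∨ clock (h b) t (x ∷ drop 1 s ∷ xs)) (p t (m⊔n≤o⇒m≤o m n m⊔n≤t)))
          (q t (m⊔n≤o⇒n≤o m n m⊔n≤t))
clock-complete (mu f) xs (⇓mu {k = k} f⇓[] f⇓∷) =
  let m , p = clock-complete f _ f⇓[]
      n , q = uniform-bound k λ j<k →
                let b , w , d = f⇓∷ j<k
                    l , r = clock-complete f _ d
                in l , λ t l≤t → b , w , r t l≤t
      l = m ⊔ n
  -- The search tests only candidates below the length of `t`, so reaching `1^ k` takes length at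
  -- least `suc k`.
  in suc k ⊔ l , λ t h →
    let l≤t = m⊔n≤o⇒n≤o (suc k) l h
    in cong found (trial-complete t (p t (m⊔n≤o⇒m≤o m n l≤t)) (q t (m⊔n≤o⇒n≤o m n l≤t)) t
                     (m⊔n≤o⇒m≤o (suc k) l h))
  where
  module _ (t : Str) (zero-at : clock f t (1^ k ∷ xs) ≡ true ∷ [])
           (nonzero-at : ∀ {j} → j < k → ∃₂ λ b w → clock f t (1^ j ∷ xs) ≡ true ∷ b ∷ w) where
    trial-below : ∀ z → length z ≤ k → trial f t xs z ≡ []
    trial-below []      _   = refl
    trial-below (_ ∷ z) z<k
      rewrite trial-below z (<⇒≤ z<k) | proj₂ (proj₂ (nonzero-at z<k)) = refl

    trial-complete : ∀ z → k < length z → trial f t xs z ≡ true ∷ 1^ k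
    trial-complete (_ ∷ z) k<1+z with m≤n⇒m<n∨m≡n k<1+z
    ... | inj₁ (s≤s k<z) rewrite trial-complete z k<z = refl
    ... | inj₂ refl rewrite trial-below z ≤-refl | zero-at = refl

clocks-complete []       xs []         = 0 , λ _ _ → refl , λ _ → refl
clocks-complete (g ∷ gs) xs (g⇓ ∷ gs⇓) =
  let m , p = clock-complete g xs g⇓
      n , q = clocks-complete gs xs gs⇓
  in m ⊔ n , λ t m⊔n≤t → both t (p t (m⊔n≤o⇒m≤o m n m⊔n≤t)) (q t (m⊔n≤o⇒n≤o m n m⊔n≤t))
  where
  both : ∀ t {y ys} → clock g t xs ≡ true ∷ y →
         map (drop 1) (clocks gs t xs) ≡ ys × (∀ z → guards (clocks gs t xs) z ≡ z) →
         map (drop 1) (clocks (g ∷ gs) t xs) ≡ y ∷ ys × (∀ z → guards (clocks (g ∷ gs) t xs) z ≡ z)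
  both t p (q , r) rewrite p = cong (_ ∷_) q , r

-- Both values are the output of the evaluator, a function, at one common large time bound.
⇓-deterministic : ∀ {n} {f : Rec n} {xs y y′} → f [ xs ]⇓ y → f [ xs ]⇓ y′ → y ≡ y′
⇓-deterministic {f = f} {xs} f⇓y f⇓y′ =
  let m , p = clock-complete f xs f⇓y
      n , q = clock-complete f xs f⇓y′
      t = 1^ (m ⊔ n)
      m⊔n≤t = ≤-reflexive (sym (length-replicate (m ⊔ n)))
  in cong (drop 1) (trans (sym (p t (m⊔n≤o⇒m≤o m n m⊔n≤t))) (q t (m⊔n≤o⇒n≤o m n m⊔n≤t)))

-- Unbounded search.

minimize : ∀ {n} {F : Vec Str (suc n) → Str} → Computable F → Rec n
minimize F = mu (code F)

least-zero : (F : ℕ → Str) → ∀ k → F k ≡ [] →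
             ∃[ j ] F j ≡ [] × (∀ {i} → i < j → ∃₂ λ b z → F i ≡ b ∷ z)
least-zero F zero    p = 0 , p , λ ()
least-zero F (suc k) p with F 0 in q
... | []    = 0 , q , λ ()
... | b ∷ z =
  let j , r , below = least-zero (F ∘ suc) k p
  in suc j , r , λ { {zero} _ → b , z , q ; {suc _} (s≤s i<j) → below i<j }

module _ {n} {F : Vec Str (suc n) → Str} (Fᶜ : Computable F) {xs : Vec Str n} where

  minimize-sound : ∀ {y} → minimize Fᶜ [ xs ]⇓ y → ∃[ k ] y ≡ 1^ k × F (1^ k ∷ xs) ≡ []
  minimize-sound (⇓mu {k = k} F⇓[] _) = k , refl , ⇓-deterministic (computes Fᶜ _) F⇓[]

  -- As `F` is total, all values before its least zero are defined, as `⇓mu` demands.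
  minimize-defined : ∀ k → F (1^ k ∷ xs) ≡ [] → ∃[ y ] minimize Fᶜ [ xs ]⇓ y
  minimize-defined k p =
    let j , q , below = least-zero (λ i → F (1^ i ∷ xs)) k p
    in 1^ j , ⇓mu (subst (code Fᶜ [ 1^ j ∷ xs ]⇓_) q (computes Fᶜ _))
                  λ {i} i<j →
                    let b , z , r = below i<j
                    in b , z , subst (code Fᶜ [ 1^ i ∷ xs ]⇓_) r (computes Fᶜ _)

-- Enumerating strings and pairs.

-- nth (1^ k) is k in bijective binary numeration, least significant digit first.

increment : Str → Str
increment []          = false ∷ []
increment (false ∷ x) = true ∷ x
increment (true ∷ x)  = false ∷ increment x

nth : Str → Str
nth []      = []
nth (_ ∷ k) = increment (nth k)

-- Putting `false` or `true` before the numeral of `k` gives the numeral of 2k+1 or 2k+2.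
nth-surjective : ∀ w → ∃[ k ] nth (1^ k) ≡ w
nth-surjective []      = 0 , refl
nth-surjective (b ∷ w) =
  let k , p = nth-surjective w in subst (λ w → ∃[ k ] nth (1^ k) ≡ b ∷ w) p (prepend b k)
  where
  prepend-false : ∀ k → ∃[ l ] nth (1^ l) ≡ false ∷ nth (1^ k)
  prepend-false zero    = 1 , refl
  prepend-false (suc k) =
    let l , p = prepend-false k in suc (suc l) , cong (increment ∘ increment) p

  prepend : ∀ b k → ∃[ l ] nth (1^ l) ≡ b ∷ nth (1^ k)
  prepend false k = prepend-false k
  prepend true  k = let l , p = prepend-false k in suc l , cong increment p

-- 1ᵗ0x encodes the pair (1ᵗ , x).

encode : ℕ → Str → Str
encode zero    x = false ∷ x
encode (suc t) x = true ∷ encode t x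

time : Str → Str
time []          = []
time (false ∷ _) = []
time (true ∷ w)  = true ∷ time w

input : Str → Str
input []          = []
input (false ∷ x) = x
input (true ∷ w)  = input w

time-encode : ∀ t x → time (encode t x) ≡ 1^ t
time-encode zero    x = refl
time-encode (suc t) x = cong (true ∷_) (time-encode t x)

input-encode : ∀ t x → input (encode t x) ≡ x
input-encode zero    x = refl
input-encode (suc t) x = input-encode t x

module _ {n} {F : Vec Str n → Str} (Fᶜ : Computable F) where

  nthᶜ : Computable (λ xs → nth (F xs))
  nthᶜ =
    recᶜ (λ k _ → nth k) []ᶜ increment-var increment-var (λ _ _ → refl) (λ _ _ → refl) ∘ᶜ Fᶜ ∷ⱽ []ⱽ
    where
    increment-var : Computable (λ (xs : Vec Str 2) → increment (lookup xs 1F))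
    increment-var = recᶜ (λ x _ → increment x) (false ∷ᶜ []ᶜ) (true ∷ᶜ var 0F) (false ∷ᶜ var 1F)
                      (λ _ _ → refl) (λ _ _ → refl) ∘ᶜ var 1F ∷ⱽ []ⱽ

  timeᶜ : Computable (λ xs → time (F xs))
  timeᶜ = recᶜ (λ w _ → time w) []ᶜ []ᶜ (true ∷ᶜ var 1F) (λ _ _ → refl) (λ _ _ → refl) ∘ᶜ Fᶜ ∷ⱽ []ⱽ

  inputᶜ : Computable (λ xs → input (F xs))
  inputᶜ = recᶜ (λ w _ → input w) []ᶜ (var 0F) (var 1F) (λ _ _ → refl) (λ _ _ → refl) ∘ᶜ Fᶜ ∷ⱽ []ⱽ

-- One search index carries both a sufficient time and a string `x` of free choice: a candidate
-- output for the interpreter, an input for the stabilization.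
halting-encoding : ∀ {n} (f : Rec n) xs {y} → f [ xs ]⇓ y → ∀ x →
                   ∃[ k ] clock f (time (nth (1^ k))) xs ≡ true ∷ y × input (nth (1^ k)) ≡ x
halting-encoding f xs f⇓y x =
  let t , p = clock-complete f xs f⇓y
      k , q = nth-surjective (encode t x)
  in k ,
     trans (cong (λ s → clock f s xs) (trans (cong time q) (time-encode t x)))
           (p (1^ t) (≤-reflexive (sym (length-replicate t)))) ,
     trans (cong input q) (input-encode t x)

-- From a description mode to a program.

module _ {D : Triples} (D-mode : IsDescriptionMode D) where
  open IsDescriptionMode D-mode

  private
    e = proj₁ enumerable

    -- The index `k` dovetails over time bounds and candidates for `y`. A halting computation gives
    -- a non-empty string, which `not` turns into truth.
    halts : Vec Str 3 → Str
    halts (k ∷ p ∷ x ∷ []) = not (clock e (time (nth k)) (p ∷ x ∷ input (nth k) ∷ []))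

    haltsᶜ : Computable halts
    haltsᶜ =
      ext (notᶜ (clockᶜ e ∘ᶜ
             timeᶜ (nthᶜ (var 0F)) ∷ⱽ var 1F ∷ⱽ var 2F ∷ⱽ inputᶜ (nthᶜ (var 0F)) ∷ⱽ []ⱽ))
          λ { (_ ∷ _ ∷ _ ∷ []) → refl }

    decodeᶜ : Computable (λ (xs : Vec Str 1) → input (nth (head xs)))
    decodeᶜ = inputᶜ (nthᶜ headᶜ)

  interpreter : Rec 2
  interpreter = comp (code decodeᶜ) (minimize haltsᶜ ∷ [])

  interpreter-sound : ∀ {p x y} → interpreter [ p ∷ x ∷ [] ]⇓ y → D p x y
  interpreter-sound {p} {x} {y} (⇓comp (k⇓ ∷ []) y⇓) with minimize-sound haltsᶜ k⇓
  ... | k , refl , h with clock e (time (nth (1^ k))) (p ∷ x ∷ input (nth (1^ k)) ∷ []) in q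
  ...   | _ ∷ z =
    subst (D p x) (⇓-deterministic (computes decodeᶜ _) y⇓)
      (Equivalence.from (proj₂ enumerable p x _) (z , clock-sound e _ _ q))

  interpreter-complete : ∀ {p x y} → D p x y → interpreter [ p ∷ x ∷ [] ]⇓ y
  interpreter-complete {p} {x} {y} Dpxy =
    let _ , e⇓       = Equivalence.to (proj₂ enumerable p x y) Dpxy
        k , q , r    = halting-encoding e (p ∷ x ∷ y ∷ []) e⇓ y
        _ , k⇓       = minimize-defined haltsᶜ k
                         (cong not (trans (cong (λ y → clock e (time (nth (1^ k))) (p ∷ x ∷ y ∷ [])) r)
                                          q))
        i⇓           = ⇓comp (k⇓ ∷ []) (computes decodeᶜ _)
    -- The search may stop at an index other than `k`; functionality of `D` makes the decoded output
    -- `y` all the same.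
    in subst (interpreter [ _ ]⇓_) (functional (interpreter-sound i⇓) Dpxy) i⇓

-- From programs to a description mode.

module Stabilization (v : Rec 2) where

  value : Str → Str → Str
  value q w = clock v (time w) (q ∷ input w ∷ [])

  -- An exceeded time bound is encoded by `[]`, which is also truth, so a computation that has not
  -- halted in time conflicts with nothing.
  compatible : Str → Str → Str → Str → Str
  compatible q x y w =
    value q w ∨ equal (drop 1 (value q w)) y ∨ not (comparable x (input w))

  -- The comparison is with every earlier halting computation, including those whose own pairs are
  -- dropped.
  all-compatible : Str → Str → Str → Str → Str
  all-compatible q x y []      = []
  all-compatible q x y (_ ∷ k) = compatible q x y (nth k) ++ all-compatible q x y k

  accept : Vec Str 4 → Str
  accept (k ∷ q ∷ x ∷ y ∷ []) =
    equal (value q (nth k)) (true ∷ y) ++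
    prefix (input (nth k)) x ++
    all-compatible q (input (nth k)) y k

  acceptᶜ : Computable accept
  acceptᶜ =
    ext (equalᶜ (valueᶜ (var 1F) (nthᶜ (var 0F))) (true ∷ᶜ var 3F) ++ᶜ
         prefixᶜ (inputᶜ (nthᶜ (var 0F))) (var 2F) ++ᶜ
         (all-compatibleᶜ ∘ᶜ var 0F ∷ⱽ var 1F ∷ⱽ inputᶜ (nthᶜ (var 0F)) ∷ⱽ var 3F ∷ⱽ []ⱽ))
        λ { (_ ∷ _ ∷ _ ∷ _ ∷ []) → refl }
    where
    module _ {n} {F G : Vec Str n → Str} (Fᶜ : Computable F) (Gᶜ : Computable G) where
      valueᶜ : Computable (λ xs → value (F xs) (G xs))
      valueᶜ = clockᶜ v ∘ᶜ timeᶜ Gᶜ ∷ⱽ Fᶜ ∷ⱽ inputᶜ Gᶜ ∷ⱽ []ⱽ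

      equalᶜ : Computable (λ xs → equal (F xs) (G xs))
      equalᶜ = prefixᶜ Fᶜ Gᶜ ++ᶜ prefixᶜ Gᶜ Fᶜ

      comparableᶜ : Computable (λ xs → comparable (F xs) (G xs))
      comparableᶜ = prefixᶜ Fᶜ Gᶜ ∨ᶜ prefixᶜ Gᶜ Fᶜ

    compatibleᶜ : ∀ {n} {F G H I : Vec Str n → Str} →
                  Computable F → Computable G → Computable H → Computable I →
                  Computable (λ xs → compatible (F xs) (G xs) (H xs) (I xs))
    compatibleᶜ F G H I =
      valueᶜ F I ∨ᶜ equalᶜ (drop₁ᶜ (valueᶜ F I)) H ∨ᶜ notᶜ (comparableᶜ G (inputᶜ I))

    all-compatibleᶜ : Computable (λ (xs : Vec Str 4) →
      all-compatible (lookup (tail xs) 0F) (lookup (tail xs) 1F) (lookup (tail xs) 2F) (head xs))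
    all-compatibleᶜ =
      recᶜ (λ k xs → all-compatible (lookup xs 0F) (lookup xs 1F) (lookup xs 2F) k)
        []ᶜ step step (λ _ _ → refl) (λ _ _ → refl)
      where
      step : Computable _
      step = compatibleᶜ (var 2F) (var 3F) (var 4F) (nthᶜ (var 0F)) ++ᶜ var 1F

  -- Compatibility is tested at `input w` and not at `x`, so acceptance passes to all extensions of
  -- `x` with the same index.
  Accepted : Str → Str → Str → ℕ → Set
  Accepted q x y k =
    value q w ≡ true ∷ y ×
    input w ≼ x ×
    (∀ {j} → j < k → compatible q (input w) y (nth (1^ j)) ≡ [])
    where w = nth (1^ k)

  all-compatible-sound : ∀ {q x y} k → all-compatible q x y (1^ k) ≡ [] →
                         ∀ {j} → j < k → compatible q x y (nth (1^ j)) ≡ []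
  all-compatible-sound {q} {x} {y} (suc k) p j<1+k with m≤n⇒m<n∨m≡n j<1+k
  ... | inj₁ (s≤s j<k) = all-compatible-sound k (++-conicalʳ (compatible q x y _) _ p) j<k
  ... | inj₂ refl      = ++-conicalˡ _ _ p

  all-compatible-complete : ∀ {q x y} k → (∀ {j} → j < k → compatible q x y (nth (1^ j)) ≡ []) →
                            all-compatible q x y (1^ k) ≡ []
  all-compatible-complete zero    _ = refl
  all-compatible-complete (suc k) p =
    ++-intro (p (n<1+n k)) (all-compatible-complete k λ j<k → p (≤-trans j<k (<⇒≤ (n<1+n k))))

  accept-sound : ∀ {q x y} k → accept (1^ k ∷ q ∷ x ∷ y ∷ []) ≡ [] → Accepted q x y k
  accept-sound {q} {x} {y} k p =
    equal-sound _ _ (++-conicalˡ _ _ p) ,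
    prefix-sound _ _ (++-conicalˡ _ _ rest) ,
    all-compatible-sound k (++-conicalʳ (prefix (input (nth (1^ k))) x) _ rest)
    where rest = ++-conicalʳ (equal (value q (nth (1^ k))) (true ∷ y)) _ p

  accept-complete : ∀ {q x y} k → Accepted q x y k → accept (1^ k ∷ q ∷ x ∷ y ∷ []) ≡ []
  accept-complete {y = y} k (p , r , s) =
    ++-intro (trans (cong (λ z → equal z (true ∷ y)) p) (equal-refl (true ∷ y)))
      (++-intro (prefix-complete r) (all-compatible-complete k s))

  Stabilized : Triples
  Stabilized q x y = ∃ (Accepted q x y)

  isDescriptionMode : IsDescriptionMode Stabilized
  isDescriptionMode = record
    { enumerable = minimize acceptᶜ , λ q x y → mk⇔
        (λ (k , a) → minimize-defined acceptᶜ k (accept-complete k a))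
        (λ (_ , k⇓) → let k , _ , p = minimize-sound acceptᶜ k⇓ in k , accept-sound k p)
    ; functional = functional
    ; stable     = λ (k , p , x₀≼x , r) x≼x′ → k , p , ≼-trans x₀≼x x≼x′ , r
    }
    where
    -- Both accepted inputs are prefixes of `x`, hence comparable, so the later pair passes its test
    -- against the earlier one only if the values agree.
    earlier : ∀ {q x y y′ j k} → j < k → Accepted q x y j → Accepted q x y′ k → y ≡ y′
    earlier {q} {y′ = y′} {j} j<k (p , x₀≼x , _) (_ , x₁≼x , r)
      with ∨-elim (value q (nth (1^ j))) (r j<k)
    ... | inj₁ v≡[] = ⊥-elim (≡∷⇒≢[] p v≡[])
    ... | inj₂ s with ∨-elim (equal (drop 1 (value q (nth (1^ j)))) y′) s
    ...   | inj₁ y≡y′ = trans (cong (drop 1) (sym p)) (equal-sound _ y′ y≡y′)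
    ...   | inj₂ ≢    = ⊥-elim (≡∷⇒≢[] (cong not (comparable-complete (≼-comparable x₁≼x x₀≼x))) ≢)

    functional : ∀ {q x y y′} → Stabilized q x y → Stabilized q x y′ → y ≡ y′
    functional (j , a) (k , b) with <-cmp j k
    ... | tri< j<k _ _  = earlier j<k a b
    ... | tri≈ _ refl _ = cong (drop 1) (trans (sym (proj₁ a)) (proj₁ b))
    ... | tri> _ _ k<j  = sym (earlier k<j b a)

  -- Of two comparable inputs with values, the longer one also receives the value of the shorter by
  -- stability, and determinism equates the two. So no computation conflicts with `(x , y)`.
  complete : ∀ {q x y} → PrefixStable (λ x y → v [ q ∷ x ∷ [] ]⇓ y) →
             v [ q ∷ x ∷ [] ]⇓ y → Stabilized q x y
  complete {q} {x} {y} v-stable v⇓y with halting-encoding v (q ∷ x ∷ []) v⇓y x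
  ... | k , p , refl = k , p , ≼-refl , λ {j} _ → agrees (nth (1^ j))
    where
    agrees : ∀ w → compatible q x y w ≡ []
    agrees w with value q w in s
    ... | []    = refl
    ... | b ∷ z with comparable x (input w) in c
    ...   | _ ∷ _ = ∨-introʳ (equal z y) refl
    ...   | []    =
      ∨-introˡ (subst (λ z → equal z y ≡ []) (same (comparable-sound x (input w) c)) (equal-refl y))
      where
      w⇓z = clock-sound v (time w) (q ∷ input w ∷ []) s

      same : x ≼ input w ⊎ input w ≼ x → y ≡ z
      same (inj₁ x≼) = ⇓-deterministic (v-stable v⇓y x≼) w⇓z
      same (inj₂ ≼x) = ⇓-deterministic v⇓y (v-stable w⇓z ≼x)

-- The two inequalities.

theorem7 : (φ : Rec 2) → IsGödelNumbering φ →
    (U : Rec 1) → IsOptimalDecompressor U →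
    (D : Triples) → IsOptimalDescriptionMode D →
    ProgramC φ U =⁺ PrefixC D
theorem7 φ gödel U U-optimal D D-optimal =
  c ⊔ c′ , λ i@(x , y) →
    (λ k (p , Dpxy , p≤k) →
      let p′ , s⇓p′ , φ⇔v = translate p
          q , U⇓p′ , q≤k+c = U≤s p′ k (p , s⇓p′ , p≤k)
          φ⇔D : ∀ x y → φ [ p′ ∷ x ∷ [] ]⇓ y ⇔ D p x y
          φ⇔D x y = mk⇔ (interpreter-sound mode ∘ Equivalence.to (φ⇔v x y))
                         (Equivalence.from (φ⇔v x y) ∘ interpreter-complete mode)
      in p′ ,
         ((λ {x} {y} {x′} φ⇓y x≼x′ →
             Equivalence.from (φ⇔D x′ y) (stable (Equivalence.to (φ⇔D x y) φ⇓y) x≼x′)) ,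
          Equivalence.from (φ⇔D x y) Dpxy) ,
         q , U⇓p′ , ≤-trans q≤k+c (+-monoʳ-≤ k (m≤m⊔n c c′))) ,
    (λ k (p , (p-stable , φ⇓y) , q , U⇓p , q≤k) →
      let v⇔φ : ∀ x y → v [ q ∷ x ∷ [] ]⇓ y ⇔ φ [ p ∷ x ∷ [] ]⇓ y
          v⇔φ x y = v-computes U⇓p
          q-accepted = complete
            (λ {x} {y} {x′} v⇓y x≼x′ →
               Equivalence.from (v⇔φ x′ y) (p-stable (Equivalence.to (v⇔φ x y) v⇓y) x≼x′))
            (Equivalence.from (v⇔φ x y) φ⇓y)
          r , Drxy , r≤k+c′ = D≤D′ i k (q , q-accepted , q≤k)
      in r , Drxy , ≤-trans r≤k+c′ (+-monoʳ-≤ k (m≤n⊔m c c′)))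
  where
  open IsOptimalDescriptionMode D-optimal using (optimal) renaming (isDescriptionMode to mode)
  open IsDescriptionMode mode using (stable)

  s = proj₁ (gödel (interpreter mode))
  translate = proj₂ (gödel (interpreter mode))

  -- The translation `s` serves as a decompressor: `p` describes its translation `p′`, so `p′` has
  -- complexity at most the length of `p` plus `c`.
  c = proj₁ (U-optimal s)
  U≤s = proj₂ (U-optimal s)

  -- The first argument is a `U`-description of a program, so the stabilized mode takes the
  -- description itself as its `p`, with no change of length.
  v : Rec 2
  v = comp φ (comp U (proj 0F ∷ []) ∷ proj 1F ∷ [])

  v-computes : ∀ {q p x y} → U [ q ∷ [] ]⇓ p → v [ q ∷ x ∷ [] ]⇓ y ⇔ φ [ p ∷ x ∷ [] ]⇓ y
  v-computes {q} {p} {x} {y} U⇓p = mk⇔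
    (λ { (⇓comp (⇓comp (⇓proj ∷ []) U⇓p′ ∷ ⇓proj ∷ []) φ⇓y) →
           subst (λ p → φ [ p ∷ x ∷ [] ]⇓ y) (⇓-deterministic U⇓p′ U⇓p) φ⇓y })
    (λ φ⇓y → ⇓comp (⇓comp (⇓proj ∷ []) U⇓p ∷ ⇓proj ∷ []) φ⇓y)

  open Stabilization v

  -- The mode is built from `φ` and `U` alone, so this constant does not depend on `x`, `y` or the
  -- program.
  c′ = proj₁ (optimal Stabilized isDescriptionMode)
  D≤D′ = proj₂ (optimal Stabilized isDescriptionMode)
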